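{- There exists an independence system $(E,\mathcal I)$ (with at least one nonempty independent set) such that $$\rho^M(\mathcal I,\mathcal I) > q(\mathcal I).$$
   Context: An independence system is a pair $(E,\mathcal I)$ with $E$ a finite set and $\mathcal I\subseteq 2^E$ such that $\emptyset\in\mathcal I$ and $B\subseteq A\in\mathcal I$ implies $B\in\mathcal I$; elements of $\mathcal I$ are called independent. For $F\subseteq E$, a basis of $F$ (with respect to $\mathcal I$) is a set $B\subseteq F$ with $B\in\mathcal I$ and $B\cup\{j\}\notin\mathcal I$ for all $j\in F\setminus B$; the set of bases of $F$ is $\mathcal B_{\mathcal I}(F)$. The rank and lower rank of $F$ are $r_{\mathcal I}(F)=\max\{|B| : B\in\mathcal B_{\mathcal I}(F)\}$ and $l_{\mathcal I}(F)=\min\{|B| : B\in\mathcal B_{\mathcal I}(F)\}$. The rank quotient of $\mathcal I$ is $$q(\mathcal I)=\min_{F\subseteq E,\ r_{\mathcal I}(F)>0}\frac{l_{\mathcal I}(F)}{r_{\mathcal I}(F)}.$$ A matroid is an independence system with rank quotient $1$; equivalently, one with the augmentation property: for all independent $I,J$ with $|I|<|J|$ there is $j\in J\setminus I$ with $I\cup\{j\}$ independent (an independence system whose only independent set is $\emptyset$ is a matroid). An inner matroid of $(E,\mathcal I)$ is a matroid $(E,\mathcal M)$ with $\mathcal M\subseteq\mathcal I$. For $\mathcal O\subseteq\mathcal I$ containing a nonempty set and an inner matroid $\mathcal M$ of $\mathcal I$, put $$\rho(\mathcal I,\mathcal O,\mathcal M)=\min_{S\in\mathcal O\setminus\{\emptyset\}}\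 \min_{S'\in\mathcal B_{\mathcal M}(S)}\frac{|S'|}{|S|}=\min_{S\in\mathcal O\setminus\{\emptyset\}}\frac{r_{\mathcal M}(S)}{|S|},$$ $$\rho^M(\mathcal I,\mathcal O)=\max\{\rho(\mathcal I,\mathcal O,\mathcal M) : \mathcal M\subseteq\mathcal I,\ (E,\mathcal M)\text{ a matroid}\}.$$ In $\rho^M(\mathcal I,\mathcal I)$ one takes $\mathcal O=\mathcal I$. -}

module Defs where

open import Data.Nat.Base as ℕ using (ℕ; NonZero; >-nonZero)
import Data.Nat.Properties as ℕ
open import Data.Integer.Base using (+_)
open import Data.Rational.Base as ℚ using (ℚ; _/_)
open import Data.Fin.Base using (Fin)
open import Data.Fin.Subset using (Subset; ⊥; ⁅_⁆; _∪_; ∣_∣; _∈_; _∉_; _⊆_; Nonempty)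
open import Data.Fin.Subset.Properties using (x∈p⇒∣p-x∣<∣p∣)
open import Data.Product.Base using (Σ-syntax; ∃-syntax; _×_; _,_)
open import Level using (Level; 0ℓ) renaming (suc to lsuc)
open import Relation.Binary.Core using (Rel)
open import Relation.Binary.PropositionalEquality.Core using (_≡_)
open import Relation.Nullary.Negation.Core using (¬_)
open import Relation.Unary using (Pred; Decidable)
import Relation.Unary as U

private variable
  n : ℕ
  ℓ : Level

-- Extrema are relations: "m is the least (greatest) element of the set P".
-- Such an m is unique for the antisymmetric orders used here, and an extremum
-- of an empty set does not exist rather than taking a default value.

IsExtremum : {A : Set} → Rel A 0ℓ → Pred A ℓ → Pred A ℓ
IsExtremum _≼_ P m = P m × (∀ x → P x → m ≼ x)

IsMinℕ IsMaxℕ : Pred ℕ ℓ → Pred ℕ ℓ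
IsMinℕ = IsExtremum ℕ._≤_
IsMaxℕ = IsExtremum ℕ._≥_

IsMinℚ IsMaxℚ : Pred ℚ ℓ → Pred ℚ ℓ
IsMinℚ = IsExtremum ℚ._≤_
IsMaxℚ = IsExtremum ℚ._≥_

-- Independence systems on the ground set E = Fin n.  Decidability makes the
-- family of independent sets a subset of the finite set 2^E in the usual
-- (classical) sense.

record IndependenceSystem (n : ℕ) : Set₁ where
  field
    Independent  : Pred (Subset n) 0ℓ
    independent? : Decidable Independent
    ⊥-indep      : Independent ⊥
    ⊆-closed     : ∀ {A B} → B ⊆ A → Independent A → Independent B

open IndependenceSystem public

IsBasis : IndependenceSystem n → Subset n → Pred (Subset n) 0ℓ
IsBasis I F B =
  B ⊆ F × Independent I B × (∀ j → j ∈ F → j ∉ B → ¬ Independent I (B ∪ ⁅ j ⁆))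

IsRank IsLowerRank : IndependenceSystem n → Subset n → Pred ℕ 0ℓ
IsRank      I F = IsMaxℕ λ k → ∃[ B ] IsBasis I F B × k ≡ ∣ B ∣
IsLowerRank I F = IsMinℕ λ k → ∃[ B ] IsBasis I F B × k ≡ ∣ B ∣

IsRankQuotient : IndependenceSystem n → Pred ℚ 0ℓ
IsRankQuotient I = IsMinℚ λ x →
  ∃[ F ] ∃[ l ] ∃[ r ] IsLowerRank I F l × IsRank I F r ×
    Σ[ r>0 ∈ r ℕ.> 0 ] x ≡ _/_ (+ l) r {{>-nonZero r>0}}

IsMatroid : IndependenceSystem n → Set
IsMatroid {n} M = ∀ (A B : Subset n) → Independent M A → Independent M B →
  ∣ A ∣ ℕ.< ∣ B ∣ → ∃[ j ] j ∈ B × j ∉ A × Independent M (A ∪ ⁅ j ⁆)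

IsInnerMatroid : IndependenceSystem n → IndependenceSystem n → Set
IsInnerMatroid I M = IsMatroid M × Independent M U.⊆ Independent I

∣nonempty∣-nonZero : {S : Subset n} → Nonempty S → NonZero ∣ S ∣
∣nonempty∣-nonZero (_ , x∈S) = >-nonZero (ℕ.≤-<-trans ℕ.z≤n (x∈p⇒∣p-x∣<∣p∣ x∈S))

-- ρ(𝓘, 𝓞, 𝓜); the value depends on 𝓘 only through the requirement that
-- 𝓜 be an inner matroid of 𝓘, which is imposed in IsRhoᴹ.

IsRho : Pred (Subset n) 0ℓ → IndependenceSystem n → Pred ℚ 0ℓ
IsRho O M = IsMinℚ λ x → ∃[ S ] O S × Σ[ S≢∅ ∈ Nonempty S ]
  IsMinℚ (λ y → ∃[ S′ ] IsBasis M S S′ ×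
    y ≡ _/_ (+ ∣ S′ ∣) ∣ S ∣ {{∣nonempty∣-nonZero S≢∅}}) x

IsRhoᴹ : IndependenceSystem n → Pred (Subset n) 0ℓ → Pred ℚ (lsuc 0ℓ)
IsRhoᴹ {n} I O = IsMaxℚ λ x →
  Σ[ M ∈ IndependenceSystem n ] IsInnerMatroid I M × IsRho O M x

{-# OPTIONS --safe #-}

-- Any inner matroid containing a basis B of F has rank at most ∣B∣ on F.  So it
-- can beat the rank quotient only if it gives up some element of
-- every small basis.  Take C of size 5 and one further element b, and let 𝓜 be
-- the partition matroid of three pairs, one of them {b , c} with c ∈ C.  The
-- system 𝓘 has as independent sets those of 𝓜, the subsets of C, and {b , c}.
-- The whole ground set has the bases {b , c} and C, so q = 2/5, while 𝓜 has
-- rank at least half the size of every set.  Conversely an inner matroid either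
-- contains {b , c}, hence has rank at most 2 on C, or has rank at most 1 on
-- {b , c}, so that ρᴹ = 1/2.

module Submission where

open import Defs
open import Data.Fin.Base using (Fin)
open import Data.Fin.Patterns using (0F; 1F; 2F)
open import Data.Fin.Properties using (all?; any?)
open import Data.Fin.Subset
  using (Subset; inside; outside; ⊥; ⊤; ⁅_⁆; ∁; _∪_; _∩_; ∣_∣; _∈_; _∉_; _⊆_; _⊃_; Nonempty)
open import Data.Fin.Subset.Induction using (Acc; acc; ⊃-wellFounded)
open import Data.Fin.Subset.Properties
open import Data.Integer.Base as ℤ using (+_)
import Data.Integer.Properties as ℤ
open import Data.Nat.Base using (ℕ; zero; suc; _*_; _≤_; NonZero; >-nonZero)
open import Data.Nat.Properties
  using (_≤?_; _<?_; ≤-trans; ≮⇒≥; *-comm; *-mono-≤; *-monoˡ-≤; *-monoʳ-≤; module ≤-Reasoning)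
open import Data.Product.Base using (Σ-syntax; ∃-syntax; _×_; _,_)
open import Data.Rational.Base as ℚ using (_>_; ½; _/_; fromℚᵘ; toℚᵘ)
import Data.Rational.Properties as ℚ
import Data.Rational.Unnormalised.Base as ℚᵘ
import Data.Rational.Unnormalised.Properties as ℚᵘ
open import Data.Sum.Base using (_⊎_; inj₁; inj₂; [_,_]′)
open import Data.Vec.Base using ([]; _∷_)
open import Function.Base using (id)
open import Level using (Level)
open import Relation.Binary.PropositionalEquality using (refl; sym; subst; subst₂)
open import Relation.Nullary using (¬_; Dec; yes; no; contradiction)
open import Relation.Nullary.Decidable
  using (map′; from-yes; _×-dec_; _⊎-dec_; _→-dec_; ¬?)
open import Relation.Unary using (Pred; Decidable)

private variable
  n : ℕ
  ℓ : Level

-- `_/_` reduces to lowest terms, so the cross-multiplied inequality is applied to the unnormalised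
-- fractions.
/-mono-≤ : ∀ a b c d .{{_ : NonZero b}} .{{_ : NonZero d}} →
  a * d ≤ c * b → + a / b ℚ.≤ + c / d
/-mono-≤ a (suc b) c (suc d) ad≤cb = ℚ.toℚᵘ-cancel-≤ (begin
  toℚᵘ (fromℚᵘ (ℚᵘ.mkℚᵘ (+ a) b))  ≃⟨ ℚ.toℚᵘ-fromℚᵘ (ℚᵘ.mkℚᵘ (+ a) b) ⟩
  ℚᵘ.mkℚᵘ (+ a) b                  ≤⟨ ℚᵘ.*≤* (subst₂ ℤ._≤_ (ℤ.pos-* a (suc d)) (ℤ.pos-* c (suc b)) (ℤ.+≤+ ad≤cb)) ⟩
  ℚᵘ.mkℚᵘ (+ c) d                  ≃⟨ ℚ.toℚᵘ-fromℚᵘ (ℚᵘ.mkℚᵘ (+ c) d) ⟨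
  toℚᵘ (fromℚᵘ (ℚᵘ.mkℚᵘ (+ c) d))  ∎)
  where open ℚᵘ.≤-Reasoning

allSubsets? : {P : Pred (Subset n) ℓ} → Decidable P → Dec (∀ S → P S)
allSubsets? {n = zero}  P? = map′ (λ { p [] → p }) (λ p → p []) (P? [])
allSubsets? {n = suc _} P? = map′
  (λ { (p , q) (inside ∷ S) → p S ; (p , q) (outside ∷ S) → q S })
  (λ p → (λ S → p (inside ∷ S)) , (λ S → p (outside ∷ S)))
  (allSubsets? (λ S → P? (inside ∷ S)) ×-dec allSubsets? (λ S → P? (outside ∷ S)))

isBasis? : (I : IndependenceSystem n) → ∀ F B → Dec (IsBasis I F B)
isBasis? I F B = B ⊆? F ×-dec independent? I B ×-dec
  all? (λ j → (j ∈? F) →-dec (¬? (j ∈? B) →-dec ¬? (independent? I (B ∪ ⁅ j ⁆))))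

∪-⊆ : ∀ {p q r : Subset n} → p ⊆ r → q ⊆ r → p ∪ q ⊆ r
∪-⊆ p⊆r q⊆r x∈p∪q = [ p⊆r , q⊆r ]′ (x∈p∪q⁻ _ _ x∈p∪q)

∪⁅⁆-⊆ : ∀ {j} {B F : Subset n} → B ⊆ F → j ∈ F → B ∪ ⁅ j ⁆ ⊆ F
∪⁅⁆-⊆ B⊆F j∈F = ∪-⊆ B⊆F λ x∈⁅j⁆ → subst (_∈ _) (sym (x∈⁅y⁆⇒x≡y _ x∈⁅j⁆)) j∈F

-- Greedy extension from `⊥`: each added element strictly enlarges the set, so the process stops.
basis-exists : (I : IndependenceSystem n) → ∀ F → ∃[ B ] IsBasis I F B
basis-exists I F = extend ⊥ (⊃-wellFounded ⊥) ⊥⊆ (⊥-indep I)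
  where
  extend : ∀ B → Acc _⊃_ B → B ⊆ F → Independent I B → ∃[ B′ ] IsBasis I F B′
  extend B (acc rec) B⊆F indep
    with any? (λ j → j ∈? F ×-dec ¬? (j ∈? B) ×-dec independent? I (B ∪ ⁅ j ⁆))
  ... | yes (j , j∈F , j∉B , indep′) =
    extend (B ∪ ⁅ j ⁆) (rec (p⊆p∪q _ , j , q⊆p∪q _ _ (x∈⁅x⁆ j) , j∉B)) (∪⁅⁆-⊆ B⊆F j∈F) indep′
  ... | no ¬extendable =
    B , B⊆F , indep , λ j j∈F j∉B indep′ → ¬extendable (j , j∈F , j∉B , indep′)

module _ (M : IndependenceSystem n) (matroid : IsMatroid M) where

  -- Otherwise augmentation would yield an element of `F` that extends the basis.
  indep-≤-basis : ∀ {F} A {B} → IsBasis M F B → A ⊆ F → Independent M A → ∣ A ∣ ≤ ∣ B ∣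
  indep-≤-basis A {B} (_ , indepB , maximal) A⊆F indepA = ≮⇒≥ λ ∣B∣<∣A∣ →
    let j , j∈A , j∉B , indep = matroid B A indepB indepA ∣B∣<∣A∣
    in maximal j (A⊆F j∈A) j∉B indep

  -- One basis of one set suffices to bound ρ: in a matroid all bases of `S` have equal size, so its
  -- ratio is already the inner minimum in `IsRho`.
  ρ-≤ : ∀ O {x S B} → IsRho O M x → O S → (S≢∅ : Nonempty S) → IsBasis M S B →
    x ℚ.≤ _/_ (+ ∣ B ∣) ∣ S ∣ {{∣nonempty∣-nonZero S≢∅}}
  ρ-≤ _ {S = S} {B} (_ , least) S∈O S≢∅ basis@(B⊆S , indepB , _) = least _
    (S , S∈O , S≢∅ , (B , basis , refl) , λ { _ (B′ , basis′ , refl) →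
      /-mono-≤ (∣ B ∣) (∣ S ∣) (∣ B′ ∣) (∣ S ∣)
        {{∣nonempty∣-nonZero S≢∅}} {{∣nonempty∣-nonZero S≢∅}}
        (*-monoˡ-≤ (∣ S ∣) (indep-≤-basis B {B′} basis′ B⊆S indepB)) })

pair : Fin 3 → Subset 6
pair 0F = inside  ∷ inside  ∷ outside ∷ outside ∷ outside ∷ outside ∷ []
pair 1F = outside ∷ outside ∷ inside  ∷ inside  ∷ outside ∷ outside ∷ []
pair 2F = outside ∷ outside ∷ outside ∷ outside ∷ inside  ∷ inside  ∷ []

-- Here b is `0F` and c is `1F`, so `C` consists of c and the two other pairs.
bc C : Subset 6
bc = pair 0F
C  = ∁ ⁅ 0F ⁆

∩-monoˡ-⊆ : ∀ {p q : Subset n} r → p ⊆ q → p ∩ r ⊆ q ∩ r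
∩-monoˡ-⊆ r p⊆q x∈p∩r =
  let x∈p , x∈r = x∈p∩q⁻ _ r x∈p∩r in x∈p∩q⁺ (p⊆q x∈p , x∈r)

𝓜 : IndependenceSystem 6
𝓜 .Independent S = ∀ i → ∣ S ∩ pair i ∣ ≤ 1
𝓜 .independent? S = all? λ i → ∣ S ∩ pair i ∣ ≤? 1
𝓜 .⊥-indep = from-yes (all? λ i → ∣ ⊥ ∩ pair i ∣ ≤? 1)
𝓜 .⊆-closed B⊆A indep i = ≤-trans (p⊆q⇒∣p∣≤∣q∣ (∩-monoˡ-⊆ (pair i) B⊆A)) (indep i)

𝓘 : IndependenceSystem 6
𝓘 .Independent S = Independent 𝓜 S ⊎ S ⊆ bc ⊎ S ⊆ C
𝓘 .independent? S = independent? 𝓜 S ⊎-dec S ⊆? bc ⊎-dec S ⊆? C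
𝓘 .⊥-indep = inj₂ (inj₁ ⊥⊆)
𝓘 .⊆-closed B⊆A (inj₁ indep)        = inj₁ (⊆-closed 𝓜 B⊆A indep)
𝓘 .⊆-closed B⊆A (inj₂ (inj₁ A⊆bc)) = inj₂ (inj₁ (⊆-trans B⊆A A⊆bc))
𝓘 .⊆-closed B⊆A (inj₂ (inj₂ A⊆C))  = inj₂ (inj₂ (⊆-trans B⊆A A⊆C))

𝓜-matroid : IsMatroid 𝓜
𝓜-matroid = from-yes (allSubsets? λ A → allSubsets? λ B →
  independent? 𝓜 A →-dec (independent? 𝓜 B →-dec (∣ A ∣ <? ∣ B ∣ →-dec
    any? λ j → j ∈? B ×-dec ¬? (j ∈? A) ×-dec independent? 𝓜 (A ∪ ⁅ j ⁆))))

-- A basis of `S` takes one element from each pair meeting `S`, and each such pair contributes at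
-- most two elements to `S`.
𝓜-rank-≥-half : ∀ S B → IsBasis 𝓜 S B → 1 * ∣ S ∣ ≤ ∣ B ∣ * 2
𝓜-rank-≥-half = from-yes (allSubsets? λ S → allSubsets? λ B →
  isBasis? 𝓜 S B →-dec (1 * ∣ S ∣ ≤? ∣ B ∣ * 2))

bc-nonempty : Nonempty bc
bc-nonempty = from-yes (nonempty? bc)

C-nonempty : Nonempty C
C-nonempty = from-yes (nonempty? C)

ρ-𝓜 : IsRho (Independent 𝓘) 𝓜 ½
ρ-𝓜 =
  (bc , inj₂ (inj₁ ⊆-refl) , bc-nonempty
      , (⁅ 0F ⁆ , from-yes (isBasis? 𝓜 bc ⁅ 0F ⁆) , refl)
      , λ { _ (B , basis , refl) → half bc-nonempty basis })
  , λ { _ (S , _ , S≢∅ , (B , basis , refl) , _) → half S≢∅ basis }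
  where
  half : ∀ {S B} (S≢∅ : Nonempty S) → IsBasis 𝓜 S B →
    ½ ℚ.≤ _/_ (+ ∣ B ∣) ∣ S ∣ {{∣nonempty∣-nonZero S≢∅}}
  half {S} {B} S≢∅ basis =
    /-mono-≤ 1 2 (∣ B ∣) (∣ S ∣) {{_}} {{∣nonempty∣-nonZero S≢∅}} (𝓜-rank-≥-half S B basis)

-- The enlarged set contains a whole pair, so it is not in `𝓜`; it contains b, so it is not inside
-- `C`; and it exceeds `bc`.
bc-maximal : ∀ j → j ∉ bc → ¬ Independent 𝓘 (bc ∪ ⁅ j ⁆)
bc-maximal = from-yes (all? λ j →
  ¬? (j ∈? bc) →-dec ¬? (independent? 𝓘 (bc ∪ ⁅ j ⁆)))

small-or-bc : ∀ S → S ⊆ bc → ∣ S ∣ ≤ 1 ⊎ bc ⊆ S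
small-or-bc = from-yes (allSubsets? λ S →
  S ⊆? bc →-dec (∣ S ∣ ≤? 1 ⊎-dec bc ⊆? S))

inner-ρ-≤-½ : ∀ {M x} → IsInnerMatroid 𝓘 M → IsRho (Independent 𝓘) M x → x ℚ.≤ ½
inner-ρ-≤-½ {M} (matroid , M⊆𝓘) isRho with independent? M bc
... | yes bc-indep =
  let B , basis@(_ , indepB , _) = basis-exists M C
      -- Being maximal in `𝓘`, `bc` is maximal in the smaller family of `M`, and thus caps the rank
      -- of `M` on every set.
      bc-basis : IsBasis M ⊤ bc
      bc-basis = ⊆⊤ , bc-indep , λ j _ j∉bc indep → bc-maximal j j∉bc (M⊆𝓘 indep)
      ∣B∣≤2 = indep-≤-basis M matroid {⊤} B {bc} bc-basis ⊆⊤ indepB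
  in ℚ.≤-trans (ρ-≤ M matroid (Independent 𝓘) {S = C} {B} isRho (inj₂ (inj₂ ⊆-refl)) C-nonempty basis)
       (/-mono-≤ (∣ B ∣) 5 1 2 (≤-trans (*-monoˡ-≤ 2 ∣B∣≤2) (from-yes (4 ≤? 5))))
... | no bc-dep =
  let B , basis@(B⊆bc , indepB , _) = basis-exists M bc
      ∣B∣≤1 = [ id
              , (λ (bc⊆B : bc ⊆ B) → contradiction (⊆-closed M {B} {bc} bc⊆B indepB) bc-dep)
              ]′ (small-or-bc B B⊆bc)
  in ℚ.≤-trans (ρ-≤ M matroid (Independent 𝓘) {S = bc} {B} isRho (inj₂ (inj₁ ⊆-refl)) bc-nonempty basis)
       (/-mono-≤ (∣ B ∣) 2 1 2 (*-monoˡ-≤ 2 ∣B∣≤1))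

-- Abstract, since the with-abstraction in bases-ratio would otherwise normalise
-- the whole search.
abstract
  small-basis-spans : ∀ F B → IsBasis 𝓘 F B → 2 ≤ ∣ B ∣ ⊎ ∣ F ∣ ≤ ∣ B ∣
  small-basis-spans = from-yes (allSubsets? λ F → allSubsets? λ B →
    isBasis? 𝓘 F B →-dec (2 ≤? ∣ B ∣ ⊎-dec ∣ F ∣ ≤? ∣ B ∣))

𝓘-indep-≤-5 : ∀ A → Independent 𝓘 A → ∣ A ∣ ≤ 5
𝓘-indep-≤-5 = from-yes (allSubsets? λ A → independent? 𝓘 A →-dec (∣ A ∣ ≤? 5))

ρᴹ-𝓘 : IsRhoᴹ 𝓘 (Independent 𝓘) ½
ρᴹ-𝓘 = (𝓜 , (𝓜-matroid , λ {_} → inj₁) , ρ-𝓜)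
     , λ { _ (M , inner , isRho) → inner-ρ-≤-½ {M} inner isRho }

lowerRank-⊤ : IsLowerRank 𝓘 ⊤ 2
lowerRank-⊤ = (bc , from-yes (isBasis? 𝓘 ⊤ bc) , refl)
  , λ { _ (B , basis , refl) →
      -- In the second alternative `B` has all 6 elements.
      [ id , ≤-trans (from-yes (2 ≤? 6)) ]′ (small-basis-spans ⊤ B basis) }

rank-⊤ : IsRank 𝓘 ⊤ 5
rank-⊤ = (C , from-yes (isBasis? 𝓘 ⊤ C) , refl)
  , λ { _ (B , (_ , indep , _) , refl) → 𝓘-indep-≤-5 B indep }

-- Every two-element set is independent in `𝓘`, so a basis with fewer than two elements is all of
-- `F` and no basis is larger. Otherwise the sizes are at least 2 and at most 5.
bases-ratio : ∀ {F B B′} → IsBasis 𝓘 F B → IsBasis 𝓘 F B′ → 2 * ∣ B′ ∣ ≤ ∣ B ∣ * 5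
bases-ratio {F} {B} {B′} basis (B′⊆F , indep′ , _) with small-basis-spans F B basis
... | inj₁ 2≤∣B∣   = *-mono-≤ 2≤∣B∣ (𝓘-indep-≤-5 B′ indep′)
... | inj₂ ∣F∣≤∣B∣ = begin
  2 * ∣ B′ ∣  ≤⟨ *-monoʳ-≤ 2 (≤-trans (p⊆q⇒∣p∣≤∣q∣ B′⊆F) ∣F∣≤∣B∣) ⟩
  2 * ∣ B ∣   ≡⟨ *-comm 2 (∣ B ∣) ⟩
  ∣ B ∣ * 2   ≤⟨ *-monoʳ-≤ (∣ B ∣) (from-yes (2 ≤? 5)) ⟩
  ∣ B ∣ * 5   ∎
  where open ≤-Reasoning

rankQuotient-𝓘 : IsRankQuotient 𝓘 (+ 2 / 5)
rankQuotient-𝓘 =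
  (⊤ , 2 , 5 , lowerRank-⊤ , rank-⊤ , from-yes (1 ≤? 5) , refl)
  , λ { _ (_ , _ , _ , ((B , basis , refl) , _) , ((B′ , basis′ , refl) , _) , r>0 , refl) →
      /-mono-≤ 2 5 (∣ B ∣) (∣ B′ ∣) {{_}} {{>-nonZero r>0}} (bases-ratio basis basis′) }

theorem9 : ∃[ n ] Σ[ I ∈ IndependenceSystem n ]
    (∃[ S ] Independent I S × Nonempty S) ×
    (∃[ ρ ] ∃[ q ] IsRhoᴹ I (Independent I) ρ × IsRankQuotient I q × ρ > q)
theorem9 = 6 , 𝓘 , (bc , inj₂ (inj₁ ⊆-refl) , bc-nonempty)
  , ½ , + 2 / 5 , ρᴹ-𝓘 , rankQuotient-𝓘 , from-yes (+ 2 / 5 ℚ.<? ½)
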